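{- Every co-bridge-free orientable prismatic graph that is not 3-colorable admits a hitting set of the triangles of size at most $5$.
   Context: A triangle is a set of three pairwise adjacent vertices. A graph $G$ is prismatic if for every triangle $T$ of $G$, every vertex not in $T$ has exactly one neighbor in $T$. The co-bridge is $C_4+2K_1$; co-bridge-free means no induced subgraph isomorphic to it. An orientation of $G$ is a choice of a cyclic permutation $\mathcal O(T)$ of each triangle $T$ such that whenever $S=\{s_1,s_2,s_3\}$ and $T=\{t_1,t_2,t_3\}$ are disjoint triangles with $s_it_i$ an edge for $1\le i\le 3$, $\mathcal O(S)$ is $s_1\to s_2\to s_3\to s_1$ if and only if $\mathcal O(T)$ is $t_1\to t_2\to t_3\to t_1$; $G$ is orientable if it admits an orientation. 3-colorable means $V(G)$ can be partitioned into three stable sets. A hitting set is a set of vertices meeting every triangle. -}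

module Defs where

open import Data.Nat using (ℕ; _+_; _≤_)
open import Data.Bool using (Bool; true; false; not; if_then_else_)
open import Data.Fin using (Fin; zero; suc)
open import Data.Product using (Σ; _×_; ∃; ∃-syntax)
open import Data.Sum using (_⊎_)
open import Data.List using (List; length)
open import Data.List.Membership.Propositional using (_∈_)
open import Relation.Nullary using (¬_)
open import Relation.Binary.PropositionalEquality using (_≡_; _≢_)
open import Function.Definitions using (Injective)

record Graph (n : ℕ) : Set where
  field
    E     : Fin n → Fin n → Bool
    sym   : ∀ u v → E u v ≡ E v u
    irref : ∀ v → E v v ≡ false

open Graph public

module _ {n : ℕ} (G : Graph n) where

  Adj : Fin n → Fin n → Set
  Adj u v = E G u v ≡ true

  -- {a,b,c} is a triangle: three pairwise adjacent vertices
  -- (distinctness follows from irreflexivity).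
  IsTriangle : Fin n → Fin n → Fin n → Set
  IsTriangle a b c = Adj a b × Adj b c × Adj a c

  nbrCount : Fin n → Fin n → Fin n → Fin n → ℕ
  nbrCount v a b c =
    (if E G v a then 1 else 0) + (if E G v b then 1 else 0) + (if E G v c then 1 else 0)

  Prismatic : Set
  Prismatic = ∀ a b c → IsTriangle a b c → ∀ v → v ≢ a → v ≢ b → v ≢ c →
              nbrCount v a b c ≡ 1

  -- Orientation: O a b c = true means that the chosen cyclic permutation of
  -- the triangle {a,b,c} is a → b → c → a.  (Values on non-triangles are
  -- irrelevant.)  O must be a well-defined cyclic permutation of each
  -- triangle: invariant under rotation, and exactly one of the two cyclic
  -- orders is chosen.
  IsOrientation : (Fin n → Fin n → Fin n → Bool) → Set
  IsOrientation O =
    (∀ a b c → IsTriangle a b c → O a b c ≡ O b c a) ×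
    (∀ a b c → IsTriangle a b c → O a c b ≡ not (O a b c)) ×
    (∀ s₁ s₂ s₃ t₁ t₂ t₃ → IsTriangle s₁ s₂ s₃ → IsTriangle t₁ t₂ t₃ →
       s₁ ≢ t₁ → s₁ ≢ t₂ → s₁ ≢ t₃ →
       s₂ ≢ t₁ → s₂ ≢ t₂ → s₂ ≢ t₃ →
       s₃ ≢ t₁ → s₃ ≢ t₂ → s₃ ≢ t₃ →
       Adj s₁ t₁ → Adj s₂ t₂ → Adj s₃ t₃ →
       O s₁ s₂ s₃ ≡ O t₁ t₂ t₃)

  Orientable : Set
  Orientable = ∃[ O ] IsOrientation O

  ThreeColorable : Set
  ThreeColorable = Σ (Fin n → Fin 3) λ col → (∀ u v → Adj u v → col u ≢ col v)

  IsHittingSet : List (Fin n) → Set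
  IsHittingSet H = ∀ a b c → IsTriangle a b c → a ∈ H ⊎ b ∈ H ⊎ c ∈ H

-- The co-bridge C₄ + 2K₁ on Fin 6: vertices 0-1-2-3-0 form a 4-cycle,
-- vertices 4 and 5 are isolated.
coBridge : Fin 6 → Fin 6 → Bool
coBridge zero (suc zero) = true
coBridge (suc zero) zero = true
coBridge (suc zero) (suc (suc zero)) = true
coBridge (suc (suc zero)) (suc zero) = true
coBridge (suc (suc zero)) (suc (suc (suc zero))) = true
coBridge (suc (suc (suc zero))) (suc (suc zero)) = true
coBridge (suc (suc (suc zero))) zero = true
coBridge zero (suc (suc (suc zero))) = true
coBridge _ _ = false

HasInducedCoBridge : {n : ℕ} → Graph n → Set
HasInducedCoBridge {n} G =
  Σ (Fin 6 → Fin n) λ f → Injective _≡_ _≡_ f × (∀ i j → E G (f i) (f j) ≡ coBridge i j)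

CoBridgeFree : {n : ℕ} → Graph n → Set
CoBridgeFree G = ¬ HasInducedCoBridge G

{-# OPTIONS --safe #-}

-- Suppose first that three rows and three columns of triangles form L(K₃,₃). Any other
-- vertex is adjacent to a transversal of this grid, i.e. to a permutation of Fin 3, and the
-- orientation makes vertices of different parity nonadjacent. If only one parity occurs, G is
-- 3-colourable; if both occur, every triangle lies in the grid and meets its diagonal.
--
-- Now assume that there is no such grid. If a triangle meets no other triangle, assigning to
-- each vertex its neighbour in it gives a 3-colouring; otherwise take triangles abc and ade.
-- If b and c both lay in further triangles, these together with abc and ade would generate a
-- grid; so a and one vertex h of abc hit all triangles meeting abc, and likewise with h' for
-- ade. By the orientation, a triangle off abc ∪ ade can be labelled xyz with x ~ a,
-- y ~ b, d and z ~ c, e. As a b y d is an induced 4-cycle, co-bridge-freeness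
-- lets each y miss at most one z, and dually. Hence three such triangles with distinct y's and
-- distinct z's would generate a grid, and König's theorem for the pairs (y, z) yields u, v
-- hitting all these triangles. The hitting set is {a, h, h', u, v}.
module Submission where

open import Defs
open import Data.Bool using (Bool; true; false; not)
import Data.Bool.Properties as Bool
open import Data.Empty using (⊥; ⊥-elim)
open import Data.Fin using (Fin; suc; _≟_; _<_)
open import Data.Fin.Patterns
open import Data.Fin.Properties using (any?; all?; <-cmp)
open import Data.List using (List; []; _∷_; length)
open import Data.List.Membership.Propositional using (_∈_; _∉_)
open import Data.List.Relation.Unary.Any using (here; there)
open import Data.Nat using (ℕ; _≤_; z≤n; s≤s)
open import Data.Product using (∃; ∃-syntax; _×_; _,_; proj₁; proj₂)
open import Data.Product.Properties using (≡-dec)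
open import Data.Sum as Sum using (_⊎_; inj₁; inj₂; [_,_]′)
open import Function using (_∘_; case_of_)
open import Function.Definitions using (Injective)
open import Relation.Binary.Definitions using (tri<; tri≈; tri>)
open import Relation.Binary.PropositionalEquality as ≡ using (_≡_; _≢_; refl; trans; cong; subst; ≢-sym)
open import Relation.Nullary using (Dec; yes; no; ¬_)
open import Relation.Nullary.Decidable using (toWitness; ¬?; _×-dec_; _⊎-dec_; _→-dec_)

-- Permutations of three indices.

⟨_,_,_⟩ : {A : Set} → A → A → A → Fin 3 → A
⟨ x , y , z ⟩ 0F = x
⟨ x , y , z ⟩ 1F = y
⟨ x , y , z ⟩ 2F = z

infixl 6 _⊕_
_⊕_ : Fin 3 → Fin 3 → Fin 3
0F ⊕ j = j
1F ⊕ j = ⟨ 1F , 2F , 0F ⟩ j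
2F ⊕ j = ⟨ 2F , 0F , 1F ⟩ j

-- The permutations i ↦ k + i and i ↦ k − i of ℤ/3 (where −i = i + i).
even odd : Fin 3 → Fin 3 → Fin 3
even k i = k ⊕ i
odd  k i = k ⊕ (i ⊕ i)

abstract
  third-index : (i j : Fin 3) → i ≢ j → ∃[ k ] (i ≢ k × j ≢ k)
  third-index = toWitness {a? = all? λ i → all? λ j → ¬? (i ≟ j) →-dec
    any? λ k → ¬? (i ≟ k) ×-dec ¬? (j ≟ k)} _

-- The graphs of `σ 0F`, `σ 1F`, `σ 2F` are three transversals that partition the cells of a 3 by 3
-- square, as the symbols of a Latin square do.
IsLatin : (Fin 3 → Fin 3 → Fin 3) → Set
IsLatin σ =
  (∀ i j → ∃[ d ] j ≡ σ d i) ×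
  (∀ d i i' → σ d i ≡ σ d i' → i ≡ i') ×
  (∀ i d d' → σ d i ≡ σ d' i → d ≡ d')

isLatin? : ∀ σ → Dec (IsLatin σ)
isLatin? σ =
  (all? λ i → all? λ j → any? λ d → j ≟ σ d i) ×-dec
  (all? λ d → all? λ i → all? λ i' → (σ d i ≟ σ d i') →-dec (i ≟ i')) ×-dec
  (all? λ i → all? λ d → all? λ d' → (σ d i ≟ σ d' i) →-dec (d ≟ d'))

abstract
  even-latin : IsLatin even
  even-latin = toWitness {a? = isLatin? even} _

  odd-latin : IsLatin odd
  odd-latin = toWitness {a? = isLatin? odd} _

  even-or-odd : ∀ p q r → p ≢ q → p ≢ r → q ≢ r →
    (∃[ k ] (p ≡ even k 0F × q ≡ even k 1F × r ≡ even k 2F)) ⊎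
    (∃[ k ] (p ≡ odd k 0F × q ≡ odd k 1F × r ≡ odd k 2F))
  even-or-odd = toWitness {a? = all? λ p → all? λ q → all? λ r →
    ¬? (p ≟ q) →-dec ¬? (p ≟ r) →-dec ¬? (q ≟ r) →-dec
    ((any? λ k → (p ≟ even k 0F) ×-dec (q ≟ even k 1F) ×-dec (r ≟ even k 2F)) ⊎-dec
     (any? λ k → (p ≟ odd k 0F) ×-dec (q ≟ odd k 1F) ×-dec (r ≟ odd k 2F)))} _

  -- The quotient of the two permutations is odd, hence a transposition: one fixed index, and an
  -- exchange on the other two.
  even-odd-agree : ∀ k l → ∃[ i ] (even k i ≡ odd l i ×
    even k (i ⊕ 1F) ≡ odd l (i ⊕ 2F) × even k (i ⊕ 2F) ≡ odd l (i ⊕ 1F))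
  even-odd-agree = toWitness {a? = all? λ k → all? λ l → any? λ i → (even k i ≟ odd l i) ×-dec
    (even k (i ⊕ 1F) ≟ odd l (i ⊕ 2F)) ×-dec (even k (i ⊕ 2F) ≟ odd l (i ⊕ 1F))} _

  ⊕-distinct : ∀ i → i ≢ i ⊕ 1F × i ≢ i ⊕ 2F × i ⊕ 1F ≢ i ⊕ 2F
  ⊕-distinct = toWitness {a? = all? λ i →
    ¬? (i ≟ i ⊕ 1F) ×-dec ¬? (i ≟ i ⊕ 2F) ×-dec ¬? (i ⊕ 1F ≟ i ⊕ 2F)} _

  ⊕-cancel : ∀ k → k ≡ k ⊕ 2F ⊕ 1F
  ⊕-cancel = toWitness {a? = all? λ k → k ≟ k ⊕ 2F ⊕ 1F} _

-- Adjacency in the co-bridge.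

twins : List (Fin 6 × Fin 6)
twins = (0F , 2F) ∷ (2F , 0F) ∷ (1F , 3F) ∷ (3F , 1F) ∷ (4F , 5F) ∷ (5F , 4F) ∷ []

abstract
  coBridge-irref : ∀ i → coBridge i i ≡ false
  coBridge-irref = toWitness {a? = all? λ i → coBridge i i Bool.≟ false} _

  coBridge-sym : ∀ i j → coBridge i j ≡ coBridge j i
  coBridge-sym = toWitness {a? = all? λ i → all? λ j → coBridge i j Bool.≟ coBridge j i} _

  -- Adjacency alone separates all vertices except twins, so an embedding of the co-bridge is
  -- injective once three pairs (opposite corners twice, isolated vertices once) have distinct
  -- images.
  coBridge-twins : ∀ i j → (∀ k → coBridge i k ≡ coBridge j k) → i ≡ j ⊎ (i , j) ∈ twins
  coBridge-twins = toWitness {a? = all? λ i → all? λ j →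
    (all? λ k → coBridge i k Bool.≟ coBridge j k) →-dec ((i ≟ j) ⊎-dec ((i , j) ∈?² twins))} _
    where open import Data.List.Membership.DecPropositional (≡-dec (_≟_ {6}) (_≟_ {6})) renaming (_∈?_ to _∈?²_)

-- Covers and matchings of a set of pairs.

-- König: if a set F of pairs is not covered by two elements, then it contains a
-- matching of size 3.
module _ {A : Set} (_≟ᴬ_ : (x y : A) → Dec (x ≡ y)) (F : A → A → Set) (R : Set) (o : A)
  (pick : ∀ u v → (∀ {y z} → F y z → y ≢ u → y ≢ v → z ≢ u → z ≢ v → R) → R)
  (matching : ∀ {y₁ z₁ y₂ z₂ y₃ z₃} → F y₁ z₁ → F y₂ z₂ → F y₃ z₃ →
     y₁ ≢ y₂ → y₁ ≢ y₃ → y₂ ≢ y₃ → z₁ ≢ z₂ → z₁ ≢ z₃ → z₂ ≢ z₃ → R)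
  where

  private
    -- A pair avoiding both centres `z₁` and `y₂` extends to a matching, because each star has two
    -- leaves and the pair can block only one of them.
    two-stars : ∀ {y₁ y₂ y₃ z₁ z₂ z₄} → F y₁ z₁ → F y₃ z₁ → F y₂ z₂ → F y₂ z₄ →
      y₁ ≢ y₂ → y₃ ≢ y₂ → y₃ ≢ y₁ → z₁ ≢ z₂ → z₁ ≢ z₄ → z₂ ≢ z₄ → R
    two-stars {y₁} {y₂} {y₃} {z₁} {z₂} {z₄} f₁₁ f₃₁ f₂₂ f₂₄ y₁≢y₂ y₃≢y₂ y₃≢y₁ z₁≢z₂ z₁≢z₄ z₂≢z₄ =
      pick z₁ y₂ λ {y} {z} f _ y≢y₂ z≢z₁ _ →
        let left : ∃[ y' ] (F y' z₁ × y' ≢ y₂ × y' ≢ y)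
            left = case y₁ ≟ᴬ y of λ where
              (yes y₁≡y) → y₃ , f₃₁ , y₃≢y₂ , λ y₃≡y → y₃≢y₁ (trans y₃≡y (≡.sym y₁≡y))
              (no y₁≢y)  → y₁ , f₁₁ , y₁≢y₂ , y₁≢y
            right : ∃[ z' ] (F y₂ z' × z₁ ≢ z' × z' ≢ z)
            right = case z₂ ≟ᴬ z of λ where
              (yes z₂≡z) → z₄ , f₂₄ , z₁≢z₄ , λ z₄≡z → z₂≢z₄ (trans z₂≡z (≡.sym z₄≡z))
              (no z₂≢z)  → z₂ , f₂₂ , z₁≢z₂ , z₂≢z
            _ , fˡ , y'≢y₂ , y'≢y = left
            _ , fʳ , z₁≢z' , z'≢z = right
        in matching fˡ fʳ f y'≢y₂ y'≢y (≢-sym y≢y₂) z₁≢z' (≢-sym z≢z₁) z'≢z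

    star : ∀ {y₁ y₂ y₃ z₁ z₂} → F y₁ z₁ → F y₂ z₂ → F y₃ z₁ →
      y₁ ≢ y₂ → z₁ ≢ z₂ → y₃ ≢ y₁ → y₃ ≢ y₂ → R
    star {y₁} {y₂} {y₃} {z₁} {z₂} f₁ f₂ f₃ y₁≢y₂ z₁≢z₂ y₃≢y₁ y₃≢y₂ =
      pick z₁ z₂ λ {y} {z} f _ _ z≢z₁ z≢z₂ → case y ≟ᴬ y₁ of λ where
        (yes refl) → matching f f₃ f₂ (≢-sym y₃≢y₁) y₁≢y₂ y₃≢y₂ z≢z₁ z≢z₂ z₁≢z₂
        (no y≢y₁) → case y ≟ᴬ y₂ of λ where
          (yes refl) → two-stars f₁ f₃ f₂ f y₁≢y₂ y₃≢y₂ y₃≢y₁ z₁≢z₂ (≢-sym z≢z₁) (≢-sym z≢z₂)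
          (no y≢y₂) → matching f₁ f₂ f y₁≢y₂ (≢-sym y≢y₁) (≢-sym y≢y₂) z₁≢z₂ (≢-sym z≢z₁) (≢-sym z≢z₂)

  könig : R
  -- The first call only has to supply some pair, so `o` is a filler. The second pair avoids both
  -- ends of the first, and the third avoids `y₁` and `y₂`, so only `z₃` can spoil the matching.
  könig = pick o o λ {y₁} {z₁} f₁ _ _ _ _ → pick y₁ z₁ λ {y₂} {z₂} f₂ y₂≢y₁ _ _ z₂≢z₁ →
    pick y₁ y₂ λ {y₃} {z₃} f₃ y₃≢y₁ y₃≢y₂ _ _ → case z₃ ≟ᴬ z₁ of λ where
      (yes refl) → star f₁ f₂ f₃ (≢-sym y₂≢y₁) (≢-sym z₂≢z₁) y₃≢y₁ y₃≢y₂
      (no z₃≢z₁) → case z₃ ≟ᴬ z₂ of λ where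
        (yes refl) → star f₂ f₁ f₃ y₂≢y₁ z₂≢z₁ y₃≢y₂ y₃≢y₁
        (no z₃≢z₂) → matching f₁ f₂ f₃ (≢-sym y₂≢y₁) (≢-sym y₃≢y₁) (≢-sym y₃≢y₂)
                       (≢-sym z₂≢z₁) (≢-sym z₃≢z₁) (≢-sym z₃≢z₂)

-- Triangles, colourings and induced co-bridges in a graph.

module _ {n : ℕ} (G : Graph n) where

  private V = Fin n

  open import Data.List.Membership.DecPropositional (_≟_ {n}) using (_∈?_)

  infix 4 _~_ _~?_
  _~_ : V → V → Set
  _~_ = Adj G

  _~?_ : ∀ u v → Dec (u ~ v)
  u ~? v = E G u v Bool.≟ true

  ~-sym : ∀ {u v} → u ~ v → v ~ u
  ~-sym {u} {v} = trans (sym G v u)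

  ~-irrefl : ∀ {v} → ¬ v ~ v
  ~-irrefl {v} v~v = case trans (≡.sym (irref G v)) v~v of λ ()

  ~⇒≢ : ∀ {u v} → u ~ v → u ≢ v
  ~⇒≢ u~v refl = ~-irrefl u~v

  ≁⇒false : ∀ {u v} → ¬ u ~ v → E G u v ≡ false
  ≁⇒false = Bool.¬-not

  separated : ∀ {u v w} → u ~ w → ¬ v ~ w → u ≢ v
  separated u~w v≁w refl = v≁w u~w

  private
    Tri : V → V → V → Set
    Tri = IsTriangle G

  rotate : ∀ {a b c} → Tri a b c → Tri b c a
  rotate (ab , bc , ac) = bc , ~-sym ac , ~-sym ab

  flip : ∀ {a b c} → Tri a b c → Tri a c b
  flip (ab , bc , ac) = ac , ~-sym bc , ab

  Tri₃ : (Fin 3 → V) → Set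
  Tri₃ t = Tri (t 0F) (t 1F) (t 2F)

  tri-adj : ∀ t → Tri₃ t → ∀ {i j} → i ≢ j → t i ~ t j
  tri-adj t T {0F} {0F} i≢j = ⊥-elim (i≢j refl)
  tri-adj t T {0F} {1F} _ = proj₁ T
  tri-adj t T {0F} {2F} _ = proj₂ (proj₂ T)
  tri-adj t T {1F} {0F} _ = ~-sym (proj₁ T)
  tri-adj t T {1F} {1F} i≢j = ⊥-elim (i≢j refl)
  tri-adj t T {1F} {2F} _ = proj₁ (proj₂ T)
  tri-adj t T {2F} {0F} _ = ~-sym (proj₂ (proj₂ T))
  tri-adj t T {2F} {1F} _ = ~-sym (proj₁ (proj₂ T))
  tri-adj t T {2F} {2F} i≢j = ⊥-elim (i≢j refl)

  tri₃ : ∀ t → Tri₃ t → ∀ {i j k} → i ≢ j → i ≢ k → j ≢ k → Tri (t i) (t j) (t k)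
  tri₃ t T i≢j i≢k j≢k = tri-adj t T i≢j , tri-adj t T j≢k , tri-adj t T i≢k

  threeColorable : (Col : V → Fin 3 → Set) → (∀ v → ∃ (Col v)) →
    (∀ {u v c} → u ~ v → Col u c → Col v c → ⊥) → ThreeColorable G
  threeColorable Col col proper = proj₁ ∘ col , λ u v u~v e →
    proper u~v (subst (Col u) e (proj₂ (col u))) (proj₂ (col v))

  induced-co-bridge : ∀ {p₀ p₁ p₂ p₃ p₄ p₅} →
    p₀ ~ p₁ → p₁ ~ p₂ → p₂ ~ p₃ → p₀ ~ p₃ → ¬ p₀ ~ p₂ → ¬ p₁ ~ p₃ →
    ¬ p₀ ~ p₄ → ¬ p₀ ~ p₅ → ¬ p₁ ~ p₄ → ¬ p₁ ~ p₅ → ¬ p₂ ~ p₄ → ¬ p₂ ~ p₅ →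
    ¬ p₃ ~ p₄ → ¬ p₃ ~ p₅ → ¬ p₄ ~ p₅ → p₀ ≢ p₂ → p₁ ≢ p₃ → p₄ ≢ p₅ → HasInducedCoBridge G
  induced-co-bridge {p₀} {p₁} {p₂} {p₃} {p₄} {p₅}
    a₀₁ a₁₂ a₂₃ a₀₃ n₀₂ n₁₃ n₀₄ n₀₅ n₁₄ n₁₅ n₂₄ n₂₅ n₃₄ n₃₅ n₄₅ d₀₂ d₁₃ d₄₅ =
    f , injective , edges
    where
    f : Fin 6 → V
    f 0F = p₀
    f 1F = p₁
    f 2F = p₂
    f 3F = p₃
    f 4F = p₄
    f 5F = p₅

    edges-< : ∀ i j → i < j → E G (f i) (f j) ≡ coBridge i j
    edges-< 0F 1F _ = a₀₁
    edges-< 0F 2F _ = ≁⇒false n₀₂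
    edges-< 0F 3F _ = a₀₃
    edges-< 0F 4F _ = ≁⇒false n₀₄
    edges-< 0F 5F _ = ≁⇒false n₀₅
    edges-< 1F 2F _ = a₁₂
    edges-< 1F 3F _ = ≁⇒false n₁₃
    edges-< 1F 4F _ = ≁⇒false n₁₄
    edges-< 1F 5F _ = ≁⇒false n₁₅
    edges-< 2F 3F _ = a₂₃
    edges-< 2F 4F _ = ≁⇒false n₂₄
    edges-< 2F 5F _ = ≁⇒false n₂₅
    edges-< 3F 4F _ = ≁⇒false n₃₄
    edges-< 3F 5F _ = ≁⇒false n₃₅
    edges-< 4F 5F _ = ≁⇒false n₄₅
    edges-< _ 0F ()
    edges-< (suc _) 1F (s≤s ())
    edges-< (suc (suc _)) 2F (s≤s (s≤s ()))
    edges-< (suc (suc (suc _))) 3F (s≤s (s≤s (s≤s ())))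
    edges-< (suc (suc (suc (suc _)))) 4F (s≤s (s≤s (s≤s (s≤s ()))))
    edges-< 5F 5F (s≤s (s≤s (s≤s (s≤s (s≤s ())))))

    edges : ∀ i j → E G (f i) (f j) ≡ coBridge i j
    edges i j with <-cmp i j
    ... | tri< i<j _ _ = edges-< i j i<j
    ... | tri≈ _ refl _ = trans (irref G (f i)) (≡.sym (coBridge-irref i))
    ... | tri> _ _ j<i = trans (sym G (f i) (f j)) (trans (edges-< j i j<i) (coBridge-sym j i))

    injective : Injective _≡_ _≡_ f
    injective {i} {j} fi≡fj = case coBridge-twins i j same-row of λ where
        (inj₁ i≡j) → i≡j
        (inj₂ (here refl)) → ⊥-elim (d₀₂ fi≡fj)
        (inj₂ (there (here refl))) → ⊥-elim (d₀₂ (≡.sym fi≡fj))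
        (inj₂ (there (there (here refl)))) → ⊥-elim (d₁₃ fi≡fj)
        (inj₂ (there (there (there (here refl))))) → ⊥-elim (d₁₃ (≡.sym fi≡fj))
        (inj₂ (there (there (there (there (here refl)))))) → ⊥-elim (d₄₅ fi≡fj)
        (inj₂ (there (there (there (there (there (here refl))))))) → ⊥-elim (d₄₅ (≡.sym fi≡fj))
      where
      same-row : ∀ k → coBridge i k ≡ coBridge j k
      same-row k = trans (≡.sym (edges i k)) (trans (cong (λ v → E G v (f k)) fi≡fj) (edges j k))

  Goal : Set
  Goal = ∃[ H ] (length H ≤ 5 × IsHittingSet G H)

  -- A finite search decides whether `H` already works; if it does not, the triangle found is handed
  -- to the continuation.
  avoid : ∀ H → length H ≤ 5 →
    (∀ {a b c} → Tri a b c → a ∉ H → b ∉ H → c ∉ H → Goal) → Goal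
  avoid H |H|≤5 k = case avoiding? of λ where
      (yes (_ , _ , _ , T , a∉ , b∉ , c∉)) → k T a∉ b∉ c∉
      (no ∄) → H , |H|≤5 , λ a b c T → case (a ∈? H) ⊎-dec (b ∈? H) ⊎-dec (c ∈? H) of λ where
        (yes hit) → hit
        (no miss) → ⊥-elim (∄ (a , b , c , T , miss ∘ inj₁ , miss ∘ inj₂ ∘ inj₁ , miss ∘ inj₂ ∘ inj₂))
    where
    avoiding? = any? λ a → any? λ b → any? λ c →
      ((a ~? b) ×-dec (b ~? c) ×-dec (a ~? c)) ×-dec
      ¬? (a ∈? H) ×-dec ¬? (b ∈? H) ×-dec ¬? (c ∈? H)

  -- Prismatic graphs.

  module _ (prismatic : Prismatic G) where

    third : ∀ {a b c v} → Tri a b c → v ~ a → v ~ b → v ≡ c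
    third {a} {b} {c} {v} T va vb = case v ≟ c of λ where
        (yes v≡c) → v≡c
        (no v≢c) → ⊥-elim (absurd (prismatic a b c T v (~⇒≢ va) (~⇒≢ vb) v≢c))
      where
      absurd : nbrCount G v a b c ≢ 1
      absurd eq rewrite va | vb with E G v c
      ... | true = case eq of λ ()
      ... | false = case eq of λ ()

    must : ∀ {a b c v} → Tri a b c → v ≢ a → v ≢ b → v ≢ c → v ~ a ⊎ v ~ b ⊎ v ~ c
    must {a} {b} {c} {v} T v≢a v≢b v≢c with E G v a | E G v b | E G v c | prismatic a b c T v v≢a v≢b v≢c
    ... | true  | _     | _     | _ = inj₁ refl
    ... | false | true  | _     | _ = inj₂ (inj₁ refl)
    ... | false | false | true  | _ = inj₂ (inj₂ refl)
    ... | false | false | false | ()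

    third₃ : ∀ t → Tri₃ t → ∀ {i j k v} → i ≢ j → i ≢ k → j ≢ k → v ~ t i → v ~ t j → v ≡ t k
    third₃ t T i≢j i≢k j≢k = third (tri₃ t T i≢j i≢k j≢k)

    two : ∀ t → Tri₃ t → ∀ {i j v} → i ≢ j → v ~ t i → v ~ t j → (∀ k → v ≢ t k) → ⊥
    two t T {i} {j} i≢j vi vj v∉t =
      let k , i≢k , j≢k = third-index i j i≢j in v∉t k (third₃ t T i≢j i≢k j≢k vi vj)

    must₃ : ∀ t → Tri₃ t → ∀ {v} → (∀ k → v ≢ t k) → ∃[ k ] v ~ t k
    must₃ t T v∉t = case must T (v∉t 0F) (v∉t 1F) (v∉t 2F) of λ where
      (inj₁ v~) → 0F , v~
      (inj₂ (inj₁ v~)) → 1F , v~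
      (inj₂ (inj₂ v~)) → 2F , v~

    isolated-triangle⇒3-colorable : ∀ t → Tri₃ t →
      (∀ k {u v} → Tri (t k) u v → (∀ j → u ≢ t j) → ⊥) → ThreeColorable G
    isolated-triangle⇒3-colorable t T isolated = threeColorable Col col proper
      where
      Col : V → Fin 3 → Set
      -- The shift by one keeps the class stable: an outside neighbour of `t c` does not see
      -- `t (c ⊕ 1F)`, and two adjacent ones would form a second triangle at `t c`.
      Col v c = v ≡ t (c ⊕ 1F) ⊎ ((∀ k → v ≢ t k) × v ~ t c)
      col : ∀ v → ∃ (Col v)
      col v = case any? (λ k → v ≟ t k) of λ where
        (yes (k , v≡)) → k ⊕ 2F , inj₁ (trans v≡ (cong t (⊕-cancel k)))
        (no v∉) → let v∉t = λ k e → v∉ (k , e) ; k , v~ = must₃ t T v∉t in k , inj₂ (v∉t , v~)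
      proper : ∀ {u v c} → u ~ v → Col u c → Col v c → ⊥
      proper u~v (inj₁ refl) (inj₁ refl) = ~-irrefl u~v
      proper {c = c} u~v (inj₁ refl) (inj₂ (v∉ , v~)) = two t T (proj₁ (⊕-distinct c)) v~ (~-sym u~v) v∉
      proper {c = c} u~v (inj₂ (u∉ , u~)) (inj₁ refl) = two t T (proj₁ (⊕-distinct c)) u~ u~v u∉
      proper {c = c} u~v (inj₂ (u∉ , u~)) (inj₂ (_ , v~)) = isolated c (~-sym u~ , u~v , ~-sym v~) u∉

    -- Grids of triangles.

    -- Without apart, a single triangle filled into a Latin square would qualify.
    record Grid : Set where
      field
        w     : Fin 3 → Fin 3 → V
        rows  : ∀ i → Tri₃ (w i)
        cols  : ∀ j → Tri₃ (λ i → w i j)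
        apart : ∀ {i i' j j'} → i ≢ i' → j ≢ j' → w i j ≢ w i' j'

    -- If some t j ≡ s j' with j ≢ j', then the rows coincide up to a rotation, so two inequalities suffice.
    rows-apart : ∀ t s → Tri₃ t → Tri₃ s → (∀ j → t j ~ s j) → t 0F ≢ s 1F → t 0F ≢ s 2F →
      ∀ {j j'} → j ≢ j' → t j ≢ s j'
    rows-apart t s T S t~s t₀≢s₁ t₀≢s₂ = go
      where
      propagate : ∀ j j' j'' → j ≢ j' → j ≢ j'' → j' ≢ j'' → t j ≡ s j' → t j' ≡ s j''
      -- Given `t j ≡ s j'`, the vertex `s j''` sees both `t j` and `t j''`, so it is the third
      -- vertex `t j'`.
      propagate j j' j'' j≢j' j≢j'' j'≢j'' e = ≡.sym (third₃ t T j≢j'' j≢j' (≢-sym j'≢j'')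
        (~-sym (subst (_~ s j'') (≡.sym e) (tri-adj s S j'≢j''))) (~-sym (t~s j'')))
      go : ∀ {j j'} → j ≢ j' → t j ≢ s j'
      go {0F} {0F} j≢j' = ⊥-elim (j≢j' refl)
      go {1F} {1F} j≢j' = ⊥-elim (j≢j' refl)
      go {2F} {2F} j≢j' = ⊥-elim (j≢j' refl)
      go {0F} {1F} _ = t₀≢s₁
      go {0F} {2F} _ = t₀≢s₂
      go {1F} {2F} _ = t₀≢s₁ ∘ propagate 2F 0F 1F (λ ()) (λ ()) (λ ()) ∘ propagate 1F 2F 0F (λ ()) (λ ()) (λ ())
      go {2F} {0F} _ = t₀≢s₁ ∘ propagate 2F 0F 1F (λ ()) (λ ()) (λ ())
      go {1F} {0F} _ = t₀≢s₂ ∘ propagate 1F 0F 2F (λ ()) (λ ()) (λ ())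
      go {2F} {1F} _ = t₀≢s₂ ∘ propagate 1F 0F 2F (λ ()) (λ ()) (λ ()) ∘ propagate 2F 1F 0F (λ ()) (λ ()) (λ ())

    mkGrid : ∀ r₀ r₁ r₂ → Tri₃ r₀ → Tri₃ r₁ → Tri₃ r₂ → (∀ j → Tri (r₀ j) (r₁ j) (r₂ j)) →
      r₀ 0F ≢ r₁ 1F → r₀ 0F ≢ r₁ 2F → r₀ 0F ≢ r₂ 1F → r₀ 0F ≢ r₂ 2F →
      r₁ 0F ≢ r₂ 1F → r₁ 0F ≢ r₂ 2F → Grid
    mkGrid r₀ r₁ r₂ R₀ R₁ R₂ C s₁ s₂ s₃ s₄ s₅ s₆ = record
      { w = w
      ; rows = λ { 0F → R₀ ; 1F → R₁ ; 2F → R₂ }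
      ; cols = C
      ; apart = apart _ _
      }
      where
      w = ⟨ r₀ , r₁ , r₂ ⟩
      d₀₁ = rows-apart r₀ r₁ R₀ R₁ (proj₁ ∘ C) s₁ s₂
      d₀₂ = rows-apart r₀ r₂ R₀ R₂ (proj₂ ∘ proj₂ ∘ C) s₃ s₄
      d₁₂ = rows-apart r₁ r₂ R₁ R₂ (proj₁ ∘ proj₂ ∘ C) s₅ s₆
      apart : ∀ i i' {j j'} → i ≢ i' → j ≢ j' → w i j ≢ w i' j'
      apart 0F 0F i≢i' = ⊥-elim (i≢i' refl)
      apart 1F 1F i≢i' = ⊥-elim (i≢i' refl)
      apart 2F 2F i≢i' = ⊥-elim (i≢i' refl)
      apart 0F 1F _ = d₀₁
      apart 0F 2F _ = d₀₂
      apart 1F 2F _ = d₁₂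
      apart 1F 0F _ j≢j' = ≢-sym (d₀₁ (≢-sym j≢j'))
      apart 2F 0F _ j≢j' = ≢-sym (d₀₂ (≢-sym j≢j'))
      apart 2F 1F _ j≢j' = ≢-sym (d₁₂ (≢-sym j≢j'))

    -- Vertices outside a grid.

    module _ (grid : Grid) where
      open Grid grid

      private
        Out : V → Set
        Out v = ∀ i j → v ≢ w i j

        Trace : (Fin 3 → Fin 3) → V → Set
        Trace π v = ∀ i → v ~ w i (π i)

        Parity : (Fin 3 → Fin 3 → Fin 3) → V → Set
        Parity σ v = ∃[ k ] Trace (σ k) v

      row-adj : ∀ {i j j'} → j ≢ j' → w i j ~ w i j'
      row-adj {i} = tri-adj (w i) (rows i)

      col-adj : ∀ {i i' j} → i ≢ i' → w i j ~ w i' j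
      col-adj {j = j} = tri-adj (λ i → w i j) (cols j)

      -- Otherwise `w i j` has two neighbours in row `i'`, one of them in its own column, and so
      -- equals the third vertex of that row, against `apart`.
      diagonal-nonadj : ∀ {i i' j j'} → i ≢ i' → j ≢ j' → ¬ w i j ~ w i' j'
      diagonal-nonadj {i} {i'} {j} {j'} i≢i' j≢j' wij~ =
        let k , j≢k , j'≢k = third-index j j' j≢j'
        in apart i≢i' j≢k (third₃ (w i') (rows i') j≢j' j≢k j'≢k (col-adj i≢i') wij~)

      -- The vertex has a neighbour in every row, and two of these never share a column, so their
      -- positions form a permutation.
      trace : ∀ {v} → Out v → Parity even v ⊎ Parity odd v
      trace {v} v∉ = Sum.map (build even) (build odd)
          (even-or-odd (π 0F) (π 1F) (π 2F) (π-inj (λ ())) (π-inj (λ ())) (π-inj (λ ())))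
        where
        π : Fin 3 → Fin 3
        π i = proj₁ (must₃ (w i) (rows i) (v∉ i))
        v~ : ∀ i → v ~ w i (π i)
        v~ i = proj₂ (must₃ (w i) (rows i) (v∉ i))
        π-inj : ∀ {i i'} → i ≢ i' → π i ≢ π i'
        π-inj {i} {i'} i≢i' e = two (λ k → w k (π i)) (cols (π i)) i≢i' (v~ i)
          (subst (λ j → v ~ w i' j) (≡.sym e) (v~ i')) (λ k → v∉ k (π i))
        build : ∀ σ → ∃[ k ] (π 0F ≡ σ k 0F × π 1F ≡ σ k 1F × π 2F ≡ σ k 2F) → Parity σ v
        build σ (k , e₀ , e₁ , e₂) = k , λ where
          0F → subst (λ j → v ~ w 0F j) e₀ (v~ 0F)
          1F → subst (λ j → v ~ w 1F j) e₁ (v~ 1F)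
          2F → subst (λ j → v ~ w 2F j) e₂ (v~ 2F)

      distinct-rows : ∀ {i i' j j'} → i ≢ i' → w i j ≢ w i' j'
      distinct-rows {j = j} {j'} i≢i' = case j ≟ j' of λ where
        (yes refl) → ~⇒≢ (col-adj i≢i')
        (no j≢j')  → apart i≢i' j≢j'

      -- An edge lies in at most one triangle, whereas `u v` would form one with each of the common
      -- neighbours in rows 0 and 1.
      same-trace⇒nonadj : ∀ π {u v} → Trace π u → Trace π v → ¬ u ~ v
      same-trace⇒nonadj _ u~ v~ u~v =
        distinct-rows (λ ()) (third (u~v , v~ 0F , u~ 0F) (~-sym (u~ 1F)) (~-sym (v~ 1F)))

      -- Colour `c` joins the outer vertices of trace `σ c` to the grid transversal `σ (c ⊕ 1F)`.
      -- Both are stable, and no edge joins them since an outer vertex has one neighbour per row and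
      -- the two transversals are disjoint.
      one-parity⇒3-colorable : ∀ σ → IsLatin σ → (∀ v → Out v → Parity σ v) → ThreeColorable G
      one-parity⇒3-colorable σ (class , σ-injʳ , σ-injˡ) tr = threeColorable Col col proper
        where
        Col : V → Fin 3 → Set
        Col v c = (∃[ i ] v ≡ w i (σ (c ⊕ 1F) i)) ⊎ (Out v × Trace (σ c) v)
        col : ∀ v → ∃ (Col v)
        col v = case any? (λ i → any? λ j → v ≟ w i j) of λ where
          (yes (i , j , v≡)) → let d , j≡ = class i j in
            d ⊕ 2F , inj₁ (i , trans v≡ (cong (w i) (trans j≡ (cong (λ d' → σ d' i) (⊕-cancel d)))))
          (no ∄) → let v∉ = λ i j e → ∄ (i , j , e) ; k , v~ = tr v v∉ in k , inj₂ (v∉ , v~)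
        clash : ∀ i c {v} → v ~ w i (σ (c ⊕ 1F) i) → Out v → Trace (σ c) v → ⊥
        clash i c v~wi v∉ v~ =
          two (w i) (rows i) (proj₁ (⊕-distinct c) ∘ σ-injˡ i c (c ⊕ 1F)) (v~ i) v~wi (v∉ i)
        proper : ∀ {u v c} → u ~ v → Col u c → Col v c → ⊥
        proper {c = c} u~v (inj₁ (i , refl)) (inj₁ (i' , refl)) = case i ≟ i' of λ where
          (yes refl) → ~-irrefl u~v
          (no i≢i')  → diagonal-nonadj i≢i' (i≢i' ∘ σ-injʳ (c ⊕ 1F) i i') u~v
        proper {c = c} u~v (inj₁ (i , refl)) (inj₂ (v∉ , v~)) = clash i c (~-sym u~v) v∉ v~
        proper {c = c} u~v (inj₂ (u∉ , u~)) (inj₁ (i , refl)) = clash i c u~v u∉ u~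
        proper {c = c} u~v (inj₂ (_ , u~)) (inj₂ (_ , v~)) = same-trace⇒nonadj (σ c) u~ v~ u~v

      -- Orientations of a graph with a grid.

      module _ (O : V → V → V → Bool) (orientation : IsOrientation G O) where

        -- A triangle on two such vertices and their common neighbour would get opposite
        -- orientations from the two rows that avoid that neighbour.
        even-odd-nonadj : ∀ {u v} → Out u → Out v → Parity even u → Parity odd v → ¬ u ~ v
        even-odd-nonadj {u} {v} u∉ v∉ (k , u~) (l , v~) u~v = Bool.not-¬ refl twisted
          where
          i₀ = proj₁ (even-odd-agree k l)
          i₁ = i₀ ⊕ 1F
          i₂ = i₀ ⊕ 2F
          i₀≢i₁ = proj₁ (⊕-distinct i₀)
          i₀≢i₂ = proj₁ (proj₂ (⊕-distinct i₀))
          i₁≢i₂ = proj₂ (proj₂ (⊕-distinct i₀))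
          j₀ = even k i₀
          j₁ = even k i₁
          j₂ = even k i₂
          j₀≢j₁ : j₀ ≢ j₁
          j₀≢j₁ = i₀≢i₁ ∘ proj₁ (proj₂ even-latin) k i₀ i₁
          j₀≢j₂ : j₀ ≢ j₂
          j₀≢j₂ = i₀≢i₂ ∘ proj₁ (proj₂ even-latin) k i₀ i₂
          j₁≢j₂ : j₁ ≢ j₂
          j₁≢j₂ = i₁≢i₂ ∘ proj₁ (proj₂ even-latin) k i₁ i₂
          agree = proj₂ (even-odd-agree k l)
          v~₀ : v ~ w i₀ j₀
          v~₀ = subst (λ j → v ~ w i₀ j) (≡.sym (proj₁ agree)) (v~ i₀)
          v~₁ : v ~ w i₁ j₂
          v~₁ = subst (λ j → v ~ w i₁ j) (≡.sym (proj₂ (proj₂ agree))) (v~ i₁)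
          v~₂ : v ~ w i₂ j₁
          v~₂ = subst (λ j → v ~ w i₂ j) (≡.sym (proj₁ (proj₂ agree))) (v~ i₂)
          row = λ i → tri₃ (w i) (rows i) j₀≢j₁ j₀≢j₂ j₁≢j₂
          T : Tri (w i₀ j₀) u v
          T = ~-sym (u~ i₀) , u~v , ~-sym v~₀
          o₁ : O (w i₀ j₀) u v ≡ O (w i₁ j₀) (w i₁ j₁) (w i₁ j₂)
          o₁ = proj₂ (proj₂ orientation) _ _ _ _ _ _ T (row i₁)
            (distinct-rows i₀≢i₁) (distinct-rows i₀≢i₁) (distinct-rows i₀≢i₁)
            (u∉ _ _) (u∉ _ _) (u∉ _ _) (v∉ _ _) (v∉ _ _) (v∉ _ _)
            (col-adj i₀≢i₁) (u~ i₁) v~₁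
          o₂ : O (w i₀ j₀) v u ≡ O (w i₂ j₀) (w i₂ j₁) (w i₂ j₂)
          o₂ = proj₂ (proj₂ orientation) _ _ _ _ _ _ (flip T) (row i₂)
            (distinct-rows i₀≢i₂) (distinct-rows i₀≢i₂) (distinct-rows i₀≢i₂)
            (v∉ _ _) (v∉ _ _) (v∉ _ _) (u∉ _ _) (u∉ _ _) (u∉ _ _)
            (col-adj i₀≢i₂) v~₂ (u~ i₂)
          o₃ : O (w i₁ j₀) (w i₁ j₁) (w i₁ j₂) ≡ O (w i₂ j₀) (w i₂ j₁) (w i₂ j₂)
          o₃ = proj₂ (proj₂ orientation) _ _ _ _ _ _ (row i₁) (row i₂)
            (distinct-rows i₁≢i₂) (distinct-rows i₁≢i₂) (distinct-rows i₁≢i₂)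
            (distinct-rows i₁≢i₂) (distinct-rows i₁≢i₂) (distinct-rows i₁≢i₂)
            (distinct-rows i₁≢i₂) (distinct-rows i₁≢i₂) (distinct-rows i₁≢i₂)
            (col-adj i₁≢i₂) (col-adj i₁≢i₂) (col-adj i₁≢i₂)
          twisted : O (w i₀ j₀) u v ≡ not (O (w i₀ j₀) u v)
          twisted = trans o₁ (trans o₃ (trans (≡.sym o₂) (proj₁ (proj₂ orientation) _ _ _ T)))

        private
          trace? : (σ : Fin 3 → Fin 3 → Fin 3) → Dec (∃[ v ] (Out v × Parity σ v))
          trace? σ = any? λ v → (all? λ i → all? λ j → ¬? (v ≟ w i j)) ×-dec
            any? λ k → all? λ i → v ~? w i (σ k i)

          odd-even-nonadj : ∀ {u v} → Out u → Out v → Parity odd u → Parity even v → ¬ u ~ v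
          odd-even-nonadj u∉ v∉ o e u~v = even-odd-nonadj v∉ u∉ e o (~-sym u~v)

          -- A vertex of the other parity would have to lie on the triangle or see one of its
          -- vertices, and either way two parities become adjacent.
          outer-triangle-excludes-other-parity : ∀ σ τ →
            (∀ {u v} → Out u → Out v → Parity σ u → Parity τ v → ¬ u ~ v) →
            ∀ {x y z u} → Tri x y z → Out x → Out y → Out z →
            Parity σ x → Parity σ y → Parity σ z → Out u → Parity τ u → ⊥
          outer-triangle-excludes-other-parity σ τ σ-τ-nonadj {u = u} T@(xy , yz , xz) x∉ y∉ z∉ px py pz u∉ pu =
            [ nonadj x∉ px , [ nonadj y∉ py , nonadj z∉ pz ]′ ]′
              (must T (λ { refl → nonadj y∉ py xy }) (λ { refl → nonadj z∉ pz yz })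
                      (λ { refl → nonadj x∉ px (~-sym xz) }))
            where
            nonadj : ∀ {v} → Out v → Parity σ v → ¬ u ~ v
            nonadj v∉ pv u~v = σ-τ-nonadj v∉ u∉ pv pu (~-sym u~v)

          -- Opposite parities are nonadjacent. Within one parity, a common grid neighbour
          -- determines the trace because the transversals are disjoint, and equal traces are
          -- nonadjacent.
          no-outer-edge : ∀ {u v i j} → Out u → Out v → u ~ w i j → v ~ w i j → ¬ u ~ v
          no-outer-edge {u} {v} {i} {j} u∉ v∉ u~ v~ u~v = case trace u∉ , trace v∉ of λ where
              (inj₁ p , inj₂ q) → even-odd-nonadj u∉ v∉ p q u~v
              (inj₂ p , inj₁ q) → odd-even-nonadj u∉ v∉ p q u~v
              (inj₁ p , inj₁ q) → same even even-latin p q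
              (inj₂ p , inj₂ q) → same odd odd-latin p q
            where
            position : ∀ {π x} → Out x → Trace π x → x ~ w i j → π i ≡ j
            position {π} x∉ tx x~ = case π i ≟ j of λ where
              (yes e) → e
              (no ne) → ⊥-elim (two (w i) (rows i) ne (tx i) x~ (x∉ i))
            same : ∀ σ → IsLatin σ → Parity σ u → Parity σ v → ⊥
            same σ latin (k , tu) (l , tv)
              with proj₂ (proj₂ latin) i k l (trans (position {σ k} u∉ tu u~) (≡.sym (position {σ l} v∉ tv v~)))
            ... | refl = same-trace⇒nonadj (σ k) tu tv u~v

        grid⇒goal : ¬ ThreeColorable G → Goal
        grid⇒goal not-3-colorable = case trace? even of λ where
            (no ∄even) → ⊥-elim (not-3-colorable (one-parity⇒3-colorable odd odd-latin λ v v∉ →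
              [ (λ e → ⊥-elim (∄even (v , v∉ , e))) , (λ o → o) ]′ (trace v∉)))
            (yes (e , e∉ , pe)) → case trace? odd of λ where
              (no ∄odd) → ⊥-elim (not-3-colorable (one-parity⇒3-colorable even even-latin λ v v∉ →
                [ (λ e → e) , (λ o → ⊥-elim (∄odd (v , v∉ , o))) ]′ (trace v∉)))
              (yes (o , o∉ , po)) → avoid diagonal (s≤s (s≤s (s≤s z≤n)))
                λ T x∉ y∉ z∉ → ⊥-elim (impossible e∉ pe o∉ po T (off x∉) (off y∉) (off z∉))
          where
          diagonal = w 0F 0F ∷ w 1F 1F ∷ w 2F 2F ∷ []

          Off : V → Set
          Off v = ∀ i → v ≢ w i i

          off : ∀ {v} → v ∉ diagonal → Off v
          off v∉ 0F = v∉ ∘ here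
          off v∉ 1F = v∉ ∘ there ∘ here
          off v∉ 2F = v∉ ∘ there ∘ there ∘ here

          -- Two adjacent grid vertices share a row or a column; its diagonal vertex sees both and
          -- must be the third vertex of the triangle.
          inside : ∀ {i j i' j' v} → Off (w i j) → Off (w i' j') → Off v → Tri (w i j) (w i' j') v → ⊥
          inside {i} {j} {i'} {j'} offᵢ offᵢ' offᵥ T@(adj , _) = case (i ≟ i') , (j ≟ j') of λ where
            (yes refl , _) → offᵥ i (≡.sym (third T (row-adj (λ e → offᵢ i (cong (w i) (≡.sym e))))
                                                   (row-adj (λ e → offᵢ' i (cong (w i) (≡.sym e))))))
            (_ , yes refl) → offᵥ j (≡.sym (third T (col-adj (λ e → offᵢ j (cong (λ k → w k j) (≡.sym e))))
                                                   (col-adj (λ e → offᵢ' j (cong (λ k → w k j) (≡.sym e))))))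
            (no i≢i' , no j≢j') → diagonal-nonadj i≢i' j≢j' adj

          inside? : ∀ v → (∃[ i ] ∃[ j ] v ≡ w i j) ⊎ Out v
          inside? v = case any? (λ i → any? λ j → v ≟ w i j) of λ where
            (yes (i , j , e)) → inj₁ (i , j , e)
            (no ∄) → inj₂ λ i j e → ∄ (i , j , e)

          meeting : ∀ {i j y z} → Off (w i j) → Off y → Off z → Tri (w i j) y z → ⊥
          meeting {y = y} {z} offˣ offʸ offᶻ T@(xy , yz , xz) = case inside? y , inside? z of λ where
            (inj₁ (_ , _ , refl) , _) → inside offˣ offʸ offᶻ T
            (_ , inj₁ (_ , _ , refl)) → inside offˣ offᶻ offʸ (flip T)
            (inj₂ y∉ , inj₂ z∉) → no-outer-edge y∉ z∉ (~-sym xy) (~-sym xz) yz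

          impossible : ∀ {e o x y z} → Out e → Parity even e → Out o → Parity odd o → Tri x y z → Off x → Off y → Off z → ⊥
          impossible {x = x} {y} {z} e∉ ev o∉ od T@(xy , yz , xz) offˣ offʸ offᶻ =
            case inside? x , inside? y , inside? z of λ where
              (inj₁ (_ , _ , refl) , _) → meeting offˣ offʸ offᶻ T
              (_ , inj₁ (_ , _ , refl) , _) → meeting offʸ offᶻ offˣ (rotate T)
              (_ , _ , inj₁ (_ , _ , refl)) → meeting offᶻ offˣ offʸ (rotate (rotate T))
              (inj₂ x∉ , inj₂ y∉ , inj₂ z∉) → case trace x∉ , trace y∉ , trace z∉ of λ where
                (inj₁ p , inj₂ q , _) → even-odd-nonadj x∉ y∉ p q xy
                (inj₂ p , inj₁ q , _) → odd-even-nonadj x∉ y∉ p q xy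
                (inj₁ p , _ , inj₂ q) → even-odd-nonadj x∉ z∉ p q xz
                (inj₂ p , _ , inj₁ q) → odd-even-nonadj x∉ z∉ p q xz
                (inj₁ p , inj₁ q , inj₁ r) → outer-triangle-excludes-other-parity even odd even-odd-nonadj T x∉ y∉ z∉ p q r o∉ od
                (inj₂ p , inj₂ q , inj₂ r) → outer-triangle-excludes-other-parity odd even odd-even-nonadj T x∉ y∉ z∉ p q r e∉ ev

    -- Matched triangles and branching vertices.

    module _ (O : V → V → V → Bool) (orientation : IsOrientation G O)
             (not-3-colorable : ¬ ThreeColorable G) where

      private
        O-rotate : ∀ {a b c} → Tri a b c → O a b c ≡ O b c a
        O-rotate = proj₁ orientation _ _ _

        O-flip : ∀ {a b c} → Tri a b c → O a c b ≡ not (O a b c)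
        O-flip = proj₁ (proj₂ orientation) _ _ _

      -- The four inequalities together with `x ~ x'` make the triangles disjoint, so by
      -- prismaticity the edges between them form a perfect matching. Whether it is parallel or
      -- crossed is visible in `O`.
      match : ∀ {x y z x' y' z'} → Tri x y z → Tri x' y' z' → x ~ x' →
        x ≢ y' → x ≢ z' → x' ≢ y → x' ≢ z →
        (y ~ y' × z ~ z' × O x y z ≡ O x' y' z') ⊎
        (y ~ z' × z ~ y' × O x y z ≡ not (O x' y' z'))
      match {x} {y} {z} {x'} {y'} {z'} T@(xy , yz , xz) T'@(_ , _ , x'z') xx' x≢y' x≢z' x'≢y x'≢z =
        case must T' (≢-sym x'≢y) y≢y' y≢z' , must T' (≢-sym x'≢z) z≢y' z≢z' of λ where
          (inj₁ yx' , _) → ⊥-elim (x'≢z (third T (~-sym xx') (~-sym yx')))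
          (_ , inj₁ zx') → ⊥-elim (x'≢y (third (flip T) (~-sym xx') (~-sym zx')))
          (inj₂ (inj₁ yy') , inj₂ (inj₁ zy')) →
            ⊥-elim (x≢y' (≡.sym (third (rotate T) (~-sym yy') (~-sym zy'))))
          (inj₂ (inj₂ yz') , inj₂ (inj₂ zz')) →
            ⊥-elim (x≢z' (≡.sym (third (rotate T) (~-sym yz') (~-sym zz'))))
          (inj₂ (inj₁ yy') , inj₂ (inj₂ zz')) → inj₁ (yy' , zz' ,
            proj₂ (proj₂ orientation) _ _ _ _ _ _ T T' (~⇒≢ xx') x≢y' x≢z'
              (≢-sym x'≢y) y≢y' y≢z' (≢-sym x'≢z) z≢y' z≢z' xx' yy' zz')
          (inj₂ (inj₂ yz') , inj₂ (inj₁ zy')) → inj₂ (yz' , zy' , trans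
            (proj₂ (proj₂ orientation) _ _ _ _ _ _ T (flip T') (~⇒≢ xx') x≢z' x≢y'
              (≢-sym x'≢y) y≢z' y≢y' (≢-sym x'≢z) z≢z' z≢y' xx' yz' zy') (O-flip T'))
        where
        y≢y' : y ≢ y'
        y≢y' refl = x≢z' (third T' xx' xy)
        y≢z' : y ≢ z'
        y≢z' refl = x≢y' (third (flip T') xx' xy)
        z≢y' : z ≢ y'
        z≢y' refl = x≢z' (third T' xx' xz)
        z≢z' : z ≢ z'
        z≢z' refl = x≢y' (third (flip T') xx' xz)

      -- Exchanging `y'` and `z'` turns the crossed case of `match` into the parallel one; `P`
      -- carries side conditions through the exchange.
      align : ∀ {x y z x' y' z'} (P : V → Set) → Tri x y z → Tri x' y' z' → x ~ x' →
        x ≢ y' → x ≢ z' → x' ≢ y → x' ≢ z → P y' → P z' →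
        ∃[ u ] ∃[ v ] (Tri x' u v × y ~ u × z ~ v × O x y z ≡ O x' u v × P u × P v)
      align P T T' xx' x≢y' x≢z' x'≢y x'≢z py' pz' = case match T T' xx' x≢y' x≢z' x'≢y x'≢z of λ where
        (inj₁ (yy' , zz' , o)) → _ , _ , T' , yy' , zz' , o , py' , pz'
        (inj₂ (yz' , zy' , o)) → _ , _ , flip T' , yz' , zy' , trans o (≡.sym (O-flip T')) , pz' , py'

      -- That v also differs from b and c is then automatic, see other.
      Branching : V → V → V → Set
      Branching a b c = ∃[ u ] ∃[ v ] (Tri a u v × u ≢ b × u ≢ c)

      branching? : ∀ a b c → Dec (Branching a b c)
      branching? a b c = any? λ u → any? λ v →
        ((a ~? u) ×-dec (u ~? v) ×-dec (a ~? v)) ×-dec ¬? (u ≟ b) ×-dec ¬? (u ≟ c)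

      other : ∀ {a b c u v} → Tri a b c → Tri a u v → u ≢ b → u ≢ c → v ≢ b × v ≢ c
      other T (au , uv , _) u≢b u≢c =
        (λ { refl → u≢c (third T (~-sym au) uv) }) , (λ { refl → u≢b (third (flip T) (~-sym au) uv) })

      -- The rows start with `a b c`, and the columns are the further triangles at `a`, `b` and `c`.
      -- Those at `b` and `c` are aligned with `a d e`, hence have equal orientation, which forces
      -- them to match each other in parallel and closes the other two rows.
      branching-triangle⇒grid : ∀ {a b c d e} → Tri a b c → Tri a d e → d ≢ b → d ≢ c →
        Branching b a c → Branching c a b → Grid
      branching-triangle⇒grid {a} {b} {c} {d} {e} T@(ab , bc , ac) S@(ad , de , _) d≢b d≢c
        (_ , _ , B₀ , p₀≢a , p₀≢c) (_ , _ , C₀ , r₀≢a , r₀≢b) =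
        let e≢b , e≢c = other T S d≢b d≢c
            q₀≢a , q₀≢c = other (flip (rotate T)) B₀ p₀≢a p₀≢c
            s₀≢a , s₀≢b = other (rotate (rotate T)) C₀ r₀≢a r₀≢b
            p , q , B , dp , eq , o₁ , (p≢a , p≢c) , (q≢a , q≢c) =
              align (λ v → v ≢ a × v ≢ c) S B₀ ab (≢-sym p₀≢a) (≢-sym q₀≢a) (≢-sym d≢b) (≢-sym e≢b)
                (p₀≢a , p₀≢c) (q₀≢a , q₀≢c)
            r , s , C , dr , es , o₂ , (r≢a , r≢b) , (s≢a , s≢b) =
              align (λ v → v ≢ a × v ≢ b) S C₀ ac (≢-sym r₀≢a) (≢-sym s₀≢a) (≢-sym d≢c) (≢-sym e≢c)
                (r₀≢a , r₀≢b) (s₀≢a , s₀≢b)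
            q≁a = λ qa → q≢c (third T qa (~-sym (proj₂ (proj₂ B))))
            s≁a = λ sa → s≢b (third (flip T) sa (~-sym (proj₂ (proj₂ C))))
        in case match B C bc (≢-sym r≢b) (≢-sym s≢b) (≢-sym p≢c) (≢-sym q≢c) of λ where
          (inj₁ (pr , qs , _)) → mkGrid ⟨ a , b , c ⟩ ⟨ d , p , r ⟩ ⟨ e , q , s ⟩
            T (dp , pr , dr) (eq , qs , es) (λ { 0F → S ; 1F → B ; 2F → C })
            (≢-sym p≢a) (≢-sym r≢a) (≢-sym q≢a) (≢-sym s≢a)
            (separated (~-sym ad) q≁a) (separated (~-sym ad) s≁a)
          (inj₂ (_ , _ , o₃)) → ⊥-elim (Bool.not-¬ (trans (≡.sym o₁) o₂) o₃)

      -- The set `{a, h}` hits every triangle meeting `{a, b, c}`. The condition speaks of the first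
      -- vertex, so that rotating the triangle covers all three.
      Covers : V → V → V → V → Set
      Covers h a b c = ∀ {x y z} → Tri x y z → x ≢ a → y ≢ a → x ≢ h → y ≢ h → x ≢ b × x ≢ c

      -- If `b` does not branch, take `h` to be `c`, and conversely: a triangle through a
      -- nonbranching vertex is `abc` itself. If both branch, there is a grid.
      cover : ∀ {a b c d e} → Tri a b c → Tri a d e → d ≢ b → d ≢ c →
        (∀ h → Covers h a b c → Goal) → Goal
      cover {a} {b} {c} T S d≢b d≢c k with branching? b a c | branching? c a b
      ... | no ∄ | _ = k c λ X x≢a y≢a x≢c y≢c → (λ { refl → ∄ (_ , _ , X , y≢a , y≢c) }) , x≢c
      ... | _ | no ∄ = k b λ X x≢a y≢a x≢b y≢b → x≢b , λ { refl → ∄ (_ , _ , X , y≢a , y≢b) }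
      ... | yes B | yes C = grid⇒goal (branching-triangle⇒grid T S d≢b d≢c B C) O orientation not-3-colorable

      -- Consequences of co-bridge-freeness.

      module _ (co-bridge-free : CoBridgeFree G) where

        -- The 4-cycle a b y b' together with z and z' would be a co-bridge.
        at-most-one-nonneighbour : ∀ {a b c b' c' y z z'} → Tri a b c → Tri a b' c' → b' ≢ b → b' ≢ c →
          y ~ b → y ~ b' → y ≢ a → y ≢ c →
          z ~ c → z ~ c' → z ≢ a → z ≢ b → z' ~ c → z' ~ c' → z' ≢ a → z' ≢ b →
          z ≢ z' → y ~ z ⊎ y ~ z'
        at-most-one-nonneighbour {a} {b} {c} {b'} {c'} {y} {z} {z'} T@(ab , bc , ac) T'@(ab' , b'c' , ac')
          b'≢b b'≢c yb yb' y≢a y≢c zc zc' z≢a z≢b z'c z'c' z'≢a z'≢b z≢z' =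
          case (y ~? z) ⊎-dec (y ~? z') of λ where
            (yes p) → p
            (no ¬p) → ⊥-elim (co-bridge-free (induced-co-bridge ab (~-sym yb) yb' ab'
               a≁y b≁b' (a≁ z≢b zc) (a≁ z'≢b z'c) (b≁ z≢a zc) (b≁ z'≢a z'c) (¬p ∘ inj₁) (¬p ∘ inj₂)
               (b'≁ z≢a zc') (b'≁ z'≢a z'c') z≁z' (≢-sym y≢a) (≢-sym b'≢b) z≢z'))
          where
          c'≢c = proj₂ (other T T' b'≢b b'≢c)
          a≁y : ¬ a ~ y
          a≁y ay = y≢c (third T (~-sym ay) yb)
          b≁b' : ¬ b ~ b'
          b≁b' bb' = b'≢c (third T (~-sym ab') (~-sym bb'))
          a≁ : ∀ {v} → v ≢ b → v ~ c → ¬ a ~ v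
          a≁ v≢b vc av = v≢b (third (flip T) (~-sym av) vc)
          b≁ : ∀ {v} → v ≢ a → v ~ c → ¬ b ~ v
          b≁ v≢a vc bv = v≢a (third (rotate T) (~-sym bv) vc)
          b'≁ : ∀ {v} → v ≢ a → v ~ c' → ¬ b' ~ v
          b'≁ v≢a vc' bv = v≢a (third (rotate T') (~-sym bv) vc')
          z≁z' : ¬ z ~ z'
          -- Both `c` and `c'` would complete the edge `z z'` to a triangle.
          z≁z' zz' = c'≢c (third (zz' , z'c , zc) (~-sym zc') (~-sym z'c'))

        -- Triangles off two triangles with a common vertex.

        module _ {a b c d e : V} (T : Tri a b c) (S : Tri a d e) (d≢b : d ≢ b) (d≢c : d ≢ c)
                 (T∥S : O a b c ≡ O a d e) where

          private
            e≢b = proj₁ (other T S d≢b d≢c)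
            e≢c = proj₂ (other T S d≢b d≢c)

          record Off (v : V) : Set where
            field
              ≢a : v ≢ a
              ≢b : v ≢ b
              ≢c : v ≢ c
              ≢d : v ≢ d
              ≢e : v ≢ e

          open Off

          record Transversal (x y z : V) : Set where
            field
              triangle : Tri x y z
              x-off    : Off x
              y-off    : Off y
              z-off    : Off z
              x~a      : x ~ a
              y~b      : y ~ b
              y~d      : y ~ d
              z~c      : z ~ c
              z~e      : z ~ e
              parallel : O a b c ≡ O x y z

          open Transversal

          -- Rotation brings the neighbour of `a` to the front and `align` orders the rest along
          -- `b`, `c`. As `T` and `S` have equal orientation, a crossed matching with `S` is
          -- impossible.
          transversal : ∀ (P : V → Set) {x y z} → Tri x y z → Off x → Off y → Off z → P x → P y → P z →
            ∃[ x ] ∃[ y ] ∃[ z ] (Transversal x y z × P y × P z)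
          transversal P {x} {y} {z} X x∥ y∥ z∥ px py pz =
            case must X (≢-sym (≢a x∥)) (≢-sym (≢a y∥)) (≢-sym (≢a z∥)) of λ where
              (inj₁ ax) → from ax X x∥ y∥ z∥ py pz
              (inj₂ (inj₁ ay)) → from ay (rotate X) y∥ z∥ x∥ pz px
              (inj₂ (inj₂ az)) → from az (rotate (rotate X)) z∥ x∥ y∥ px py
            where
            from : ∀ {x y z} → a ~ x → Tri x y z → Off x → Off y → Off z → P y → P z →
              ∃[ x ] ∃[ y ] ∃[ z ] (Transversal x y z × P y × P z)
            from ax X x∥ y∥ z∥ py pz
              with align (λ v → Off v × P v) T X ax (≢-sym (≢a y∥)) (≢-sym (≢a z∥)) (≢b x∥) (≢c x∥)
                     (y∥ , py) (z∥ , pz)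
            ... | u , v , Y , bu , cv , o , (u∥ , pu) , (v∥ , pv)
              with match S Y ax (≢-sym (≢a u∥)) (≢-sym (≢a v∥)) (≢d x∥) (≢e x∥)
            ... | inj₁ (du , ev , _) = _ , u , v , record
              { triangle = Y ; x-off = x∥ ; y-off = u∥ ; z-off = v∥
              ; x~a = ~-sym ax ; y~b = ~-sym bu ; y~d = ~-sym du ; z~c = ~-sym cv ; z~e = ~-sym ev
              ; parallel = o } , pu , pv
            ... | inj₂ (_ , _ , o') = ⊥-elim (Bool.not-¬ (trans (≡.sym T∥S) o) o')

          private
            variable
              x₁ x₂ x₃ y₁ y₂ y₃ z₁ z₂ z₃ : V

          y-neighbour : Transversal x₁ y₁ z₁ → Transversal x₂ y₂ z₂ → Transversal x₃ y₃ z₃ →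
            z₂ ≢ z₃ → y₁ ~ z₂ ⊎ y₁ ~ z₃
          y-neighbour X₁ X₂ X₃ = at-most-one-nonneighbour T S d≢b d≢c
            (y~b X₁) (y~d X₁) (≢a (y-off X₁)) (≢c (y-off X₁))
            (z~c X₂) (z~e X₂) (≢a (z-off X₂)) (≢b (z-off X₂))
            (z~c X₃) (z~e X₃) (≢a (z-off X₃)) (≢b (z-off X₃))

          z-neighbour : Transversal x₁ y₁ z₁ → Transversal x₂ y₂ z₂ → Transversal x₃ y₃ z₃ →
            y₂ ≢ y₃ → z₁ ~ y₂ ⊎ z₁ ~ y₃
          z-neighbour X₁ X₂ X₃ = at-most-one-nonneighbour (flip T) (flip S) e≢c e≢b
            (z~c X₁) (z~e X₁) (≢a (z-off X₁)) (≢b (z-off X₁))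
            (y~b X₂) (y~d X₂) (≢a (y-off X₂)) (≢c (y-off X₂))
            (y~b X₃) (y~d X₃) (≢a (y-off X₃)) (≢c (y-off X₃))

          x≢y : Transversal x₁ y₁ z₁ → Transversal x₂ y₂ z₂ → x₁ ≢ y₂
          x≢y X₁ X₂ refl = ≢c (x-off X₁) (third T (x~a X₁) (y~b X₂))

          x≢z : Transversal x₁ y₁ z₁ → Transversal x₂ y₂ z₂ → x₁ ≢ z₂
          x≢z X₁ X₂ refl = ≢b (x-off X₁) (third (flip T) (x~a X₁) (z~c X₂))

          -- Both triangles are oriented like `a b c`, so the matching through `y₁ z₂` respects the
          -- cyclic order of the labels and is a shift by one.
          link : Transversal x₁ y₁ z₁ → Transversal x₂ y₂ z₂ → y₁ ≢ y₂ → z₁ ≢ z₂ → y₁ ~ z₂ →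
            z₁ ~ x₂ × x₁ ~ y₂
          link X₁ X₂ y₁≢y₂ z₁≢z₂ yz =
            case match (rotate t₁) (rotate (rotate t₂)) yz (≢-sym (x≢y X₂ X₁)) y₁≢y₂
                   (≢-sym z₁≢z₂) (≢-sym (x≢z X₁ X₂)) of λ where
              (inj₁ (zx , xy , _)) → zx , xy
              (inj₂ (_ , _ , o)) → ⊥-elim (Bool.not-¬ (trans (≡.sym (O-rotate t₁))
                (trans (≡.sym (parallel X₁)) (trans (parallel X₂) (trans (O-rotate t₂) (O-rotate (rotate t₂)))))) o)
            where
            t₁ = triangle X₁
            t₂ = triangle X₂

          -- By `link`, `y₂` sees `x₁`; seeing `z₁` as well would make it equal to `y₁`.
          one-way : Transversal x₁ y₁ z₁ → Transversal x₂ y₂ z₂ → y₁ ≢ y₂ → z₁ ≢ z₂ → y₁ ~ z₂ → ¬ y₂ ~ z₁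
          one-way X₁ X₂ y₁≢y₂ z₁≢z₂ y₁z₂ y₂z₁ = y₁≢y₂ (≡.sym (third (rotate (rotate (triangle X₁)))
            y₂z₁ (~-sym (proj₂ (link X₁ X₂ y₁≢y₂ z₁≢z₂ y₁z₂)))))

          -- By `link` each of the three edges shifts labels by one, so rotating the second triangle
          -- once and the third twice puts matched vertices into columns.
          cyclic⇒grid : Transversal x₁ y₁ z₁ → Transversal x₂ y₂ z₂ → Transversal x₃ y₃ z₃ →
            y₁ ≢ y₂ → y₁ ≢ y₃ → y₂ ≢ y₃ → z₁ ≢ z₂ → z₁ ≢ z₃ → z₂ ≢ z₃ →
            y₁ ~ z₂ → y₂ ~ z₃ → y₃ ~ z₁ → Grid
          cyclic⇒grid {x₁} {y₁} {z₁} {x₂} {y₂} {z₂} {x₃} {y₃} {z₃} X₁ X₂ X₃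
            y₁≢y₂ y₁≢y₃ y₂≢y₃ z₁≢z₂ z₁≢z₃ z₂≢z₃ y₁z₂ y₂z₃ y₃z₁ =
            let z₁x₂ , x₁y₂ = link X₁ X₂ y₁≢y₂ z₁≢z₂ y₁z₂
                z₂x₃ , x₂y₃ = link X₂ X₃ y₂≢y₃ z₂≢z₃ y₂z₃
                z₃x₁ , x₃y₁ = link X₃ X₁ (≢-sym y₁≢y₃) (≢-sym z₁≢z₃) y₃z₁
            in mkGrid ⟨ x₁ , y₁ , z₁ ⟩ ⟨ y₂ , z₂ , x₂ ⟩ ⟨ z₃ , x₃ , y₃ ⟩
              (triangle X₁) (rotate (triangle X₂)) (rotate (rotate (triangle X₃)))
              (λ { 0F → x₁y₂ , y₂z₃ , ~-sym z₃x₁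
                 ; 1F → y₁z₂ , z₂x₃ , ~-sym x₃y₁
                 ; 2F → z₁x₂ , x₂y₃ , ~-sym y₃z₁ })
              (x≢z X₁ X₂) (x-distinct X₁ X₂ z₁≢z₂ y₁z₂)
              (≢-sym (x-distinct X₃ X₁ (≢-sym z₁≢z₃) y₃z₁)) (x≢y X₁ X₃)
              (≢-sym (x≢y X₃ X₂)) y₂≢y₃
            where
            x-distinct : ∀ {x₁ x₂ y₁ y₂ z₁ z₂} → Transversal x₁ y₁ z₁ → Transversal x₂ y₂ z₂ →
              z₁ ≢ z₂ → y₁ ~ z₂ → x₁ ≢ x₂
            x-distinct X₁ X₂ z₁≢z₂ yz refl =
              z₁≢z₂ (≡.sym (third (triangle X₁) (~-sym (proj₂ (proj₂ (triangle X₂)))) (~-sym yz)))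

          -- Each `y` sees at least one of the two other `z`, and dually, while `one-way` forbids
          -- both directions between two triangles. So the edges from `y` to `z` form a directed
          -- 3-cycle, and whether `y₁ ~ z₂` decides its sense.
          matching⇒grid : Transversal x₁ y₁ z₁ → Transversal x₂ y₂ z₂ → Transversal x₃ y₃ z₃ →
            y₁ ≢ y₂ → y₁ ≢ y₃ → y₂ ≢ y₃ → z₁ ≢ z₂ → z₁ ≢ z₃ → z₂ ≢ z₃ → Grid
          matching⇒grid {y₁ = y₁} {z₂ = z₂} X₁ X₂ X₃ y₁≢y₂ y₁≢y₃ y₂≢y₃ z₁≢z₂ z₁≢z₃ z₂≢z₃ =
            case y₁ ~? z₂ of λ where
              (yes y₁z₂) →
                let y₂z₃ = first (y-neighbour X₂ X₃ X₁ (≢-sym z₁≢z₃)) (one-way X₁ X₂ y₁≢y₂ z₁≢z₂ y₁z₂)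
                    y₃z₁ = first (z-neighbour X₁ X₃ X₂ (≢-sym y₂≢y₃))
                             (one-way X₁ X₂ y₁≢y₂ z₁≢z₂ y₁z₂ ∘ ~-sym)
                in cyclic⇒grid X₁ X₂ X₃ y₁≢y₂ y₁≢y₃ y₂≢y₃ z₁≢z₂ z₁≢z₃ z₂≢z₃ y₁z₂ y₂z₃ (~-sym y₃z₁)
              (no y₁≁z₂) →
                let y₁z₃ = first (y-neighbour X₁ X₃ X₂ (≢-sym z₂≢z₃)) y₁≁z₂
                    z₂y₃ = first (z-neighbour X₂ X₃ X₁ (≢-sym y₁≢y₃)) (y₁≁z₂ ∘ ~-sym)
                    z₁y₂ = first (z-neighbour X₁ X₂ X₃ y₂≢y₃) (one-way X₁ X₃ y₁≢y₃ z₁≢z₃ y₁z₃ ∘ ~-sym)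
                in cyclic⇒grid X₁ X₃ X₂ y₁≢y₃ y₁≢y₂ (≢-sym y₂≢y₃) z₁≢z₃ z₁≢z₂ (≢-sym z₂≢z₃)
                     y₁z₃ (~-sym z₂y₃) (~-sym z₁y₂)
            where
            first : ∀ {A B : Set} → A ⊎ B → ¬ B → A
            first = λ { (inj₁ x) _ → x ; (inj₂ y) ¬y → ⊥-elim (¬y y) }

          hub⇒goal : Goal
          hub⇒goal = cover T S d≢b d≢c λ h T-covered →
            cover S T (≢-sym d≢b) (≢-sym e≢b) λ h' S-covered →
            könig _≟_ (λ y z → ∃[ x ] Transversal x y z) Goal a
              (λ u v k → avoid (a ∷ h ∷ h' ∷ u ∷ v ∷ []) (s≤s (s≤s (s≤s (s≤s (s≤s z≤n))))) λ {x} {y} {z} X x∉ y∉ z∉ →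
                let off : ∀ {x y z} → Tri x y z → x ∉ _ → y ∉ _ → Off x
                    off X x∉ y∉ =
                      let ≢b , ≢c = T-covered X (x∉ ∘ here) (y∉ ∘ here)
                                      (x∉ ∘ there ∘ here) (y∉ ∘ there ∘ here)
                          ≢d , ≢e = S-covered X (x∉ ∘ here) (y∉ ∘ here)
                                      (x∉ ∘ there ∘ there ∘ here) (y∉ ∘ there ∘ there ∘ here)
                      in record { ≢a = x∉ ∘ here ; ≢b = ≢b ; ≢c = ≢c ; ≢d = ≢d ; ≢e = ≢e }
                    -- Nonmembership is carried along as `P`, so the relabelled `y` and `z` still
                    -- avoid `u` and `v`.
                    _ , _ , _ , X' , y'∉ , z'∉ = transversal (_∉ (a ∷ h ∷ h' ∷ u ∷ v ∷ [])) X
                      (off X x∉ y∉) (off (rotate X) y∉ z∉) (off (rotate (rotate X)) z∉ x∉) x∉ y∉ z∉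
                in k (_ , X') (y'∉ ∘ there ∘ there ∘ there ∘ here) (y'∉ ∘ there ∘ there ∘ there ∘ there ∘ here)
                     (z'∉ ∘ there ∘ there ∘ there ∘ here) (z'∉ ∘ there ∘ there ∘ there ∘ there ∘ here))
              (λ (_ , X₁) (_ , X₂) (_ , X₃) y₁₂ y₁₃ y₂₃ z₁₂ z₁₃ z₂₃ →
                grid⇒goal (matching⇒grid X₁ X₂ X₃ y₁₂ y₁₃ y₂₃ z₁₂ z₁₃ z₂₃) O orientation not-3-colorable)

        -- Choice of the starting triangles.

        -- Exchanging `d` and `e` negates `O`, so one of the two labellings is oriented like
        -- `a b c`.
        branching⇒goal : ∀ {a b c} → Tri a b c → Branching a b c → Goal
        branching⇒goal {a} {b} {c} T (d , e , S , d≢b , d≢c) = case O a b c Bool.≟ O a d e of λ where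
          (yes o) → hub⇒goal T S d≢b d≢c o
          (no ¬o) → let e≢b , e≢c = other T S d≢b d≢c in
            hub⇒goal T (flip S) e≢b e≢c (trans (Bool.¬-not ¬o) (≡.sym (O-flip S)))

        triangle⇒goal : ∀ {a b c} → Tri a b c → Goal
        triangle⇒goal {a} {b} {c} T with branching? a b c | branching? b c a | branching? c a b
        ... | yes B | _ | _ = branching⇒goal T B
        ... | _ | yes B | _ = branching⇒goal (rotate T) B
        ... | _ | _ | yes B = branching⇒goal (rotate (rotate T)) B
        ... | no ¬a | no ¬b | no ¬c = ⊥-elim (not-3-colorable
          (isolated-triangle⇒3-colorable ⟨ a , b , c ⟩ T λ where
            0F X u∉ → ¬a (_ , _ , X , u∉ 1F , u∉ 2F)
            1F X u∉ → ¬b (_ , _ , X , u∉ 2F , u∉ 0F)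
            2F X u∉ → ¬c (_ , _ , X , u∉ 0F , u∉ 1F)))

        small-hitting-set : Goal
        -- The empty list suffices unless there is a triangle to start from.
        small-hitting-set = avoid [] z≤n λ T _ _ _ → triangle⇒goal T

theorem5p1 : ∀ {n : ℕ} (G : Graph n) → CoBridgeFree G → Orientable G → Prismatic G →
    ¬ ThreeColorable G → ∃[ H ] (length H ≤ 5 × IsHittingSet G H)
theorem5p1 G co-bridge-free (O , orientation) prismatic not-3-colorable =
  small-hitting-set G prismatic O orientation not-3-colorable co-bridge-free
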